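{- Let $d$ be a negative integer and $e:=|d|$. If $1\leq k \leq |d|+3$, then the $k$-th coefficient (the coefficient of $x^k$) of the generating function $L_e(x,1)$ coincides with the Catalan number $C_k=\frac{1}{k+1}\binom{2k}{k}$.
   Context: A Dyck path is a lattice path in the first quadrant that starts at the origin, ends on the $x$-axis, and consists of steps $U=(1,1)$ and $D=(1,-1)$ (never going below the $x$-axis). Its semi-length is its number of $U$ steps. A valley is an occurrence of two consecutive steps $DU$; the level of a valley is the $y$-coordinate of its lowest point. Let $\nu=(\nu_1,\dots,\nu_k)$ be the levels of all valleys of $P$, listed from left to right. For $d\in\mathbb Z$, a Dyck path is called $d$-Dyck if it has at most one valley or if $\nu_{i+1}-\nu_i\ge d$ for all $1\le i<k$. For $d<0$ and $e=|d|$, $L_e(x,1)=\sum_{n\ge 1}r_d(n)x^n$, where $r_d(n)$ is the number of $d$-Dyck paths of semi-length $n$. -}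

module Defs where

open import Data.Integer using (ℤ; +_; -_; 0ℤ; 1ℤ; -1ℤ) renaming (_+_ to _+ℤ_; _-_ to _-ℤ_; _≤_ to _≤ℤ_; _≤?_ to _≤ℤ?_; _≟_ to _≟ℤ_)
open import Data.Integer.Properties using (+-injective) renaming (+-identityˡ to +ℤ-identityˡ; +-identityʳ to +ℤ-identityʳ)
open import Data.Integer.Tactic.RingSolver using (solve-∀)
open import Data.List using (List; []; _∷_; _++_; length; map; filter)
open import Data.List.Membership.Propositional using (_∈_)
open import Data.List.Membership.Propositional.Properties using (∈-map⁺; ∈-map⁻; ∈-++⁺ˡ; ∈-++⁺ʳ; ∈-filter⁺; ∈-filter⁻)
open import Data.List.Properties using (∷-injectiveʳ)
open import Data.List.Relation.Unary.All using (All; []; _∷_; all?)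
open import Data.List.Relation.Unary.Any using (here)
open import Data.List.Relation.Unary.Linked using (Linked; linked?)
open import Data.List.Relation.Unary.Unique.Propositional using (Unique; []; _∷_)
import Data.List.Relation.Unary.Unique.Propositional.Properties as Uniqueₚ
open import Data.Nat using (ℕ; zero; suc; _+_; _*_; _/_; _≤_; _≤?_)
open import Data.Nat.Combinatorics using (_C_)
open import Data.Nat.Properties using (_≟_)
open import Data.Product using (_×_; _,_; proj₂)
open import Data.Sum using (_⊎_)
open import Function using (_∘_; _⇔_; mk⇔)
open import Relation.Binary.Definitions using (DecidableEquality)
open import Relation.Binary.PropositionalEquality using (_≡_; refl; sym; cong; subst; module ≡-Reasoning)
open import Relation.Nullary using (yes; no)
open import Relation.Nullary.Decidable using (_×-dec_; _⊎-dec_)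
open import Relation.Unary using (Decidable)

-- U = (1,1) and D = (1,-1).  The point reached after i steps has abscissa i,
-- so only ordinates are tracked below.
data Step : Set where
  U D : Step

_≟ₛ_ : DecidableEquality Step
U ≟ₛ U = yes refl
U ≟ₛ D = no λ ()
D ≟ₛ U = no λ ()
D ≟ₛ D = yes refl

Path : Set
Path = List Step

rise : Step → ℤ
rise U = 1ℤ
rise D = -1ℤ

-- Ordinates of all lattice points of the path started at ordinate y,
-- both endpoints included.
ordinatesFrom : ℤ → Path → List ℤ
ordinatesFrom y []      = y ∷ []
ordinatesFrom y (s ∷ P) = y ∷ ordinatesFrom (y +ℤ rise s) P

endFrom : ℤ → Path → ℤ
endFrom y []      = y
endFrom y (s ∷ P) = endFrom (y +ℤ rise s) P

IsDyck : Path → Set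
IsDyck P = All (0ℤ ≤ℤ_) (ordinatesFrom 0ℤ P) × endFrom 0ℤ P ≡ 0ℤ

semiLength : Path → ℕ
semiLength P = length (filter (U ≟ₛ_) P)

valleyLevelsFrom : ℤ → Path → List ℤ
valleyLevelsFrom y []          = []
valleyLevelsFrom y (U ∷ P)     = valleyLevelsFrom (y +ℤ rise U) P
valleyLevelsFrom y (D ∷ [])    = []
valleyLevelsFrom y (D ∷ D ∷ P) = valleyLevelsFrom (y +ℤ rise D) (D ∷ P)
valleyLevelsFrom y (D ∷ U ∷ P) = (y +ℤ rise D) ∷ valleyLevelsFrom (y +ℤ rise D) (U ∷ P)

valleyLevels : Path → List ℤ
valleyLevels = valleyLevelsFrom 0ℤ

Is_-Dyck : ℤ → Path → Set
Is d -Dyck P = IsDyck P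
             × (length (valleyLevels P) ≤ 1
                ⊎ Linked (λ ν ν′ → d ≤ℤ ν′ -ℤ ν) (valleyLevels P))

isDyck? : Decidable IsDyck
isDyck? P = all? (0ℤ ≤ℤ?_) (ordinatesFrom 0ℤ P) ×-dec (endFrom 0ℤ P ≟ℤ 0ℤ)

is_-Dyck? : ∀ d → Decidable (Is d -Dyck)
is d -Dyck? P = isDyck? P
  ×-dec (length (valleyLevels P) ≤? 1
         ⊎-dec linked? (λ ν ν′ → d ≤ℤ? (ν′ -ℤ ν)) (valleyLevels P))

pathsOfLength : ℕ → List Path
pathsOfLength zero    = [] ∷ []
pathsOfLength (suc m) = map (U ∷_) (pathsOfLength m) ++ map (D ∷_) (pathsOfLength m)

-- Searching among the paths with 2n steps loses nothing, and no path is listed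
-- twice: see ∈-dDyckPaths and dDyckPaths-unique below.
dDyckPaths : ℤ → ℕ → List Path
dDyckPaths d n =
  filter (λ P → is d -Dyck? P ×-dec (semiLength P ≟ n)) (pathsOfLength (2 * n))

r : ℤ → ℕ → ℕ
r d n = length (dDyckPaths d n)

-- A formal power series in x, represented by its coefficient sequence.
PowerSeries : Set
PowerSeries = ℕ → ℕ

coeff : ℕ → PowerSeries → ℕ
coeff k f = f k

-- L e is the series L_e(x,1), whose sum starts at n = 1; here d = - e.
L : ℕ → PowerSeries
L e zero      = 0
L e n@(suc _) = r (- (+ e)) n

-- The division is exact.
catalan : ℕ → ℕ
catalan k = ((2 * k) C k) / suc k

∈-pathsOfLength : ∀ P → P ∈ pathsOfLength (length P)
∈-pathsOfLength []      = here refl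
∈-pathsOfLength (U ∷ P) = ∈-++⁺ˡ (∈-map⁺ (U ∷_) (∈-pathsOfLength P))
∈-pathsOfLength (D ∷ P) =
  ∈-++⁺ʳ (map (U ∷_) (pathsOfLength (length P))) (∈-map⁺ (D ∷_) (∈-pathsOfLength P))

pathsOfLength-unique : ∀ m → Unique (pathsOfLength m)
pathsOfLength-unique zero    = [] ∷ []
pathsOfLength-unique (suc m) =
  Uniqueₚ.++⁺ (Uniqueₚ.map⁺ ∷-injectiveʳ ih) (Uniqueₚ.map⁺ ∷-injectiveʳ ih) disjoint
  where
  ih = pathsOfLength-unique m
  disjoint : ∀ {P} → P ∈ map (U ∷_) (pathsOfLength m) × P ∈ map (D ∷_) (pathsOfLength m) → _
  disjoint (p , q) with ∈-map⁻ (U ∷_) p | ∈-map⁻ (D ∷_) q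
  ... | _ , _ , refl | _ , _ , ()

end+length : ∀ y P → endFrom y P +ℤ + length P ≡ y +ℤ (+ semiLength P +ℤ + semiLength P)
end+length y []      = refl
end+length y (U ∷ P) = begin
  endFrom (y +ℤ 1ℤ) P +ℤ (1ℤ +ℤ + length P)    ≡⟨ assoc (endFrom (y +ℤ 1ℤ) P) (+ length P) ⟩
  1ℤ +ℤ (endFrom (y +ℤ 1ℤ) P +ℤ + length P)    ≡⟨ cong (1ℤ +ℤ_) (end+length (y +ℤ 1ℤ) P) ⟩
  1ℤ +ℤ ((y +ℤ 1ℤ) +ℤ (s +ℤ s))                ≡⟨ regroup y s ⟩
  y +ℤ ((1ℤ +ℤ s) +ℤ (1ℤ +ℤ s))                ∎
  where
  open ≡-Reasoning
  s = + semiLength P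
  assoc : ∀ a b → a +ℤ (1ℤ +ℤ b) ≡ 1ℤ +ℤ (a +ℤ b)
  assoc = solve-∀
  regroup : ∀ a b → 1ℤ +ℤ ((a +ℤ 1ℤ) +ℤ (b +ℤ b)) ≡ a +ℤ ((1ℤ +ℤ b) +ℤ (1ℤ +ℤ b))
  regroup = solve-∀
end+length y (D ∷ P) = begin
  endFrom (y +ℤ -1ℤ) P +ℤ (1ℤ +ℤ + length P)   ≡⟨ assoc (endFrom (y +ℤ -1ℤ) P) (+ length P) ⟩
  1ℤ +ℤ (endFrom (y +ℤ -1ℤ) P +ℤ + length P)   ≡⟨ cong (1ℤ +ℤ_) (end+length (y +ℤ -1ℤ) P) ⟩
  1ℤ +ℤ ((y +ℤ -1ℤ) +ℤ (s +ℤ s))               ≡⟨ regroup y s ⟩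
  y +ℤ (s +ℤ s)                                ∎
  where
  open ≡-Reasoning
  s = + semiLength P
  assoc : ∀ a b → a +ℤ (1ℤ +ℤ b) ≡ 1ℤ +ℤ (a +ℤ b)
  assoc = solve-∀
  regroup : ∀ a b → 1ℤ +ℤ ((a +ℤ -1ℤ) +ℤ (b +ℤ b)) ≡ a +ℤ (b +ℤ b)
  regroup = solve-∀

length-dyck : ∀ {P} → IsDyck P → length P ≡ 2 * semiLength P
length-dyck {P} (_ , end≡0) = +-injective (begin
  + length P                               ≡⟨ sym (+ℤ-identityˡ _) ⟩
  0ℤ +ℤ + length P                         ≡⟨ cong (_+ℤ + length P) (sym end≡0) ⟩
  endFrom 0ℤ P +ℤ + length P               ≡⟨ end+length 0ℤ P ⟩
  0ℤ +ℤ (+ s +ℤ + s)                       ≡⟨ +ℤ-identityˡ _ ⟩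
  + s +ℤ + s                               ≡⟨ cong (λ t → + s +ℤ t) (sym (+ℤ-identityʳ (+ s))) ⟩
  + (2 * s)                                ∎)
  where
  open ≡-Reasoning
  s = semiLength P

∈-dDyckPaths : ∀ d n P → P ∈ dDyckPaths d n ⇔ (Is d -Dyck P × semiLength P ≡ n)
∈-dDyckPaths d n P = mk⇔ (proj₂ ∘ ∈-filter⁻ P? {xs = pathsOfLength (2 * n)}) from
  where
  P? = λ Q → is d -Dyck? Q ×-dec (semiLength Q ≟ n)
  from : Is d -Dyck P × semiLength P ≡ n → P ∈ dDyckPaths d n
  from (dyck@(isDyck , _) , refl) =
    ∈-filter⁺ P? (subst (λ m → P ∈ pathsOfLength m) (length-dyck isDyck) (∈-pathsOfLength P))
              (dyck , refl)

dDyckPaths-unique : ∀ d n → Unique (dDyckPaths d n)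
dDyckPaths-unique d n = Uniqueₚ.filter⁺ _ (pathsOfLength-unique (2 * n))

{-# OPTIONS --safe #-}
module Submission where

-- Two facts give the theorem.
--
-- Every Dyck path of semi-length at most e + 3 is (- e)-Dyck.  If a valley of
-- level ν is followed by another valley, then the path makes at least ν + 1 up
-- steps before the first of the two, one more right after it, and one more right
-- after the second.  Hence ν ≤ e, and since the second valley has level at least
-- 0, the levels drop by at most e (levelDrops≤e).  So at these semi-lengths
-- r (- e) counts all Dyck paths.
--
-- The number of Dyck paths of semi-length k is the Catalan number.  Paths from
-- height h down to the axis, of length m, obey the first-step recursion of the
-- ballot numbers (length-filter-descents).  For m = h + 2u Pascal's rule shows by
-- induction on m that their number is the difference of the two adjacent
-- binomial coefficients (m C (h + u)) - (m C (h + u + 1)) (ballot-closed).  At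
-- h = 0 the absorption identity turns this difference into (2k C k) / (k + 1).

open import Defs
open import Data.Integer using (ℤ; +_; -_; 0ℤ; 1ℤ; -1ℤ; ∣_∣; +≤+) renaming (_<_ to _<ℤ_; _+_ to _+ℤ_; _-_ to _-ℤ_; _≤_ to _≤ℤ_; _≤?_ to _≤ℤ?_; _≟_ to _≟ℤ_)
import Data.Integer.Properties as ℤ
import Data.Integer.Tactic.RingSolver as ℤ-Solver
open import Data.List using (List; []; _∷_; _++_; length; map; filter)
open import Data.List.Properties using (length-map; filter-++; filter-none; filter-≐; length-++)
open import Data.List.Relation.Unary.All as All using (All; []; _∷_; all?; universal)
open import Data.List.Relation.Unary.All.Properties using (map⁺)
open import Data.List.Relation.Unary.Linked using (Linked; []; [-]; _∷_)
open import Data.Nat using (ℕ; zero; suc; _+_; _*_; _/_; _≤_; _<_; _∸_; z≤n; s≤s; s<s⁻¹)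
open import Data.Nat.Combinatorics using (_C_; nCk+nC[k+1]≡[n+1]C[k+1]; nCk≡nC[n∸k]; nC1≡n; k>n⇒nCk≡0)
open import Data.Nat.DivMod using (m*n/n≡m; /-congˡ)
open import Data.Nat.Properties using (_≟_; +-comm; +-suc; +-identityʳ; *-identityˡ; *-identityʳ; +-cancelʳ-≡; m≤m+n; m+n∸m≡n; n<1+n; suc-injective; ≤-trans; n≤1+n; *-zeroʳ; *-cancelˡ-≡)
import Data.Nat.Tactic.RingSolver as ℕ-Solver
open import Data.Product using (_×_; _,_)
open import Data.Sum using (inj₂)
open import Function using (_∘_)
open import Level using (Level)
open import Relation.Binary.PropositionalEquality using (_≡_; refl; sym; trans; cong; cong₂; subst; module ≡-Reasoning)
open import Relation.Nullary using (¬_; yes; no)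
open import Relation.Nullary.Decidable using (_×-dec_)
open import Relation.Unary using (Pred; Decidable; _≐_)

-- Short Dyck paths are d-Dyck

-- Valleys of a path above the axis have nonnegative level; having one at all
-- requires an up step.
valleyLevels-nonneg : ∀ y P → All (0ℤ ≤ℤ_) (ordinatesFrom y P) →
  All (λ ν → 0ℤ ≤ℤ ν × 1 ≤ semiLength P) (valleyLevelsFrom y P)
valleyLevels-nonneg y []          _            = []
valleyLevels-nonneg y (U ∷ P)     (_ ∷ ps)     =
  All.map (λ (p , _) → p , s≤s z≤n) (valleyLevels-nonneg _ P ps)
valleyLevels-nonneg y (D ∷ [])    _            = []
valleyLevels-nonneg y (D ∷ D ∷ P) (_ ∷ ps)     = valleyLevels-nonneg _ (D ∷ P) ps
valleyLevels-nonneg y (D ∷ U ∷ P) (_ ∷ p ∷ ps) =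
  (p , s≤s z≤n) ∷ valleyLevels-nonneg _ (U ∷ P) (p ∷ ps)

module _ (e : ℕ) where

  private
    -- From level ν to level ν′ there is a drop of at most e; this is the relation
    -- required of consecutive valley levels of a (- e)-Dyck path.
    LevelDrop≤e : ℤ → ℤ → Set
    LevelDrop≤e ν ν′ = - (+ e) ≤ℤ ν′ -ℤ ν

  Linked-∷ : ∀ {ν νs} → All (LevelDrop≤e ν) νs → Linked LevelDrop≤e νs →
    Linked LevelDrop≤e (ν ∷ νs)
  Linked-∷ []      []         = [-]
  Linked-∷ (d ∷ _) ds@[-]     = d ∷ ds
  Linked-∷ (d ∷ _) ds@(_ ∷ _) = d ∷ ds

  -- The bound is on the greatest height that the remaining up steps could
  -- reach, a quantity which never increases along a path.
  levelDrops≤e : ∀ y P → All (0ℤ ≤ℤ_) (ordinatesFrom y P) →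
    y +ℤ + semiLength P ≤ℤ + (e + 3) → Linked LevelDrop≤e (valleyLevelsFrom y P)
  levelDrops≤e y []       _        _ = []
  levelDrops≤e y (U ∷ P)  (_ ∷ ps) b =
    levelDrops≤e _ P ps (subst (_≤ℤ _) (sym (ℤ.+-assoc y 1ℤ (+ semiLength P))) b)
  levelDrops≤e y (D ∷ []) _        _ = []
  levelDrops≤e y (D ∷ D ∷ P) (_ ∷ ps) b =
    levelDrops≤e _ (D ∷ P) ps
      (ℤ.≤-trans (ℤ.+-monoˡ-≤ (+ semiLength P) (ℤ.i-j≤i y 1ℤ)) b)
  levelDrops≤e y (D ∷ U ∷ P) (_ ∷ ps@(_ ∷ ps′)) b =
    Linked-∷ (All.map drop (valleyLevels-nonneg _ P ps′))
      (levelDrops≤e _ (U ∷ P) ps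
        (ℤ.≤-trans (ℤ.+-monoˡ-≤ (+ suc (semiLength P)) (ℤ.i-j≤i y 1ℤ)) b))
    where
    lower : ∀ a → a +ℤ -1ℤ ≡ (a +ℤ + 2) +ℤ - (+ 3)
    lower = ℤ-Solver.solve-∀

    -- The valley has level y - 1.  Its own up step and the one in P that a later
    -- valley requires give y + 2 ≤ e + 3.
    level≤e : 1 ≤ semiLength P → y +ℤ -1ℤ ≤ℤ + e
    level≤e s≥1 = begin
      y +ℤ -1ℤ                                ≡⟨ lower y ⟩
      (y +ℤ + 2) +ℤ - (+ 3)                   ≤⟨ ℤ.+-monoˡ-≤ (- (+ 3)) (ℤ.+-monoʳ-≤ y (+≤+ (s≤s s≥1))) ⟩
      (y +ℤ + suc (semiLength P)) +ℤ - (+ 3)  ≤⟨ ℤ.+-monoˡ-≤ (- (+ 3)) b ⟩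
      (+ e +ℤ + 3) +ℤ - (+ 3)                 ≡⟨ ℤ.+-assoc (+ e) (+ 3) (- (+ 3)) ⟩
      + e +ℤ 0ℤ                               ≡⟨ ℤ.+-identityʳ (+ e) ⟩
      + e                                     ∎
      where open ℤ.≤-Reasoning

    drop : ∀ {ν′} → 0ℤ ≤ℤ ν′ × 1 ≤ semiLength P → LevelDrop≤e (y +ℤ -1ℤ) ν′
    drop (ν′≥0 , s≥1) =
      subst (_≤ℤ _) (ℤ.+-identityˡ _) (ℤ.+-mono-≤ ν′≥0 (ℤ.neg-mono-≤ (level≤e s≥1)))

  short⇒dDyck : ∀ {P} → IsDyck P → semiLength P ≤ e + 3 → Is (- (+ e)) -Dyck P
  short⇒dDyck {P} dyck@(nonneg , _) s≤e+3 =
    dyck , inj₂ (levelDrops≤e 0ℤ P nonneg (+≤+ s≤e+3))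

-- Counting paths down to the axis

-- The paths of length m that start at height h, never go below the axis and
-- end on it; for h = 0 these are the Dyck paths of length m.
Descent : ℕ → ℕ → Path → Set
Descent h m P =
  (All (0ℤ ≤ℤ_) (ordinatesFrom (+ h) P) × endFrom (+ h) P ≡ 0ℤ) × length P ≡ m

descent? : ∀ h m → Decidable (Descent h m)
descent? h m P =
  (all? (0ℤ ≤ℤ?_) (ordinatesFrom (+ h) P) ×-dec (endFrom (+ h) P ≟ℤ 0ℤ))
    ×-dec (length P ≟ m)

-- The ballot numbers, by the first step: ballot m h is the number of descents
-- of length m from height h.
ballot : ℕ → ℕ → ℕ
ballot zero    zero    = 1
ballot zero    (suc h) = 0
ballot (suc m) zero    = ballot m 1
ballot (suc m) (suc h) = ballot m (suc (suc h)) + ballot m h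

descent-U : ∀ h m → (Descent h (suc m) ∘ (U ∷_)) ≐ Descent (suc h) m
descent-U h m = to , from
  where
  -- The height after the up step computes to h + 1, not suc h.
  to : ∀ {P} → Descent h (suc m) (U ∷ P) → Descent (suc h) m P
  to ((_ ∷ ps , end) , len) rewrite +-comm h 1 = (ps , end) , suc-injective len
  from : ∀ {P} → Descent (suc h) m P → Descent h (suc m) (U ∷ P)
  from ((ps , end) , len) rewrite +-comm h 1 = (+≤+ z≤n ∷ ps , end) , cong suc len

descent-D : ∀ h m → (Descent (suc h) (suc m) ∘ (D ∷_)) ≐ Descent h m
descent-D h m =
  (λ { ((_ ∷ ps , end) , len) → (ps , end) , suc-injective len }) ,
  (λ { ((ps , end) , len) → (+≤+ z≤n ∷ ps , end) , cong suc len })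

¬descent-D : ∀ m P → ¬ Descent 0 m (D ∷ P)
¬descent-D m []      ((_ ∷ () ∷ _ , _) , _)
¬descent-D m (_ ∷ _) ((_ ∷ () ∷ _ , _) , _)

private variable
  a b p q : Level
  A : Set a
  B : Set b

filter-map : {P : Pred B p} (P? : Decidable P) (f : A → B) (xs : List A) →
  filter P? (map f xs) ≡ map f (filter (P? ∘ f) xs)
filter-map P? f []       = refl
filter-map P? f (x ∷ xs) with P? (f x)
... | yes _ = cong (f x ∷_) (filter-map P? f xs)
... | no  _ = filter-map P? f xs

length-filter-map : {P : Pred B p} (P? : Decidable P) {Q : Pred A q} (Q? : Decidable Q)
  (f : A → B) → (P ∘ f) ≐ Q → (xs : List A) →
  length (filter P? (map f xs)) ≡ length (filter Q? xs)
length-filter-map P? Q? f P∘f≐Q xs = begin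
  length (filter P? (map f xs))        ≡⟨ cong length (filter-map P? f xs) ⟩
  length (map f (filter (P? ∘ f) xs))  ≡⟨ length-map f (filter (P? ∘ f) xs) ⟩
  length (filter (P? ∘ f) xs)          ≡⟨ cong length (filter-≐ (P? ∘ f) Q? P∘f≐Q xs) ⟩
  length (filter Q? xs)                ∎
  where open ≡-Reasoning

length-filter-descents : ∀ m h →
  length (filter (descent? h m) (pathsOfLength m)) ≡ ballot m h
length-filter-descents zero    zero    = refl
length-filter-descents zero    (suc h) = refl
length-filter-descents (suc m) h = begin
  length (filter F? (Us ++ Ds))                       ≡⟨ cong length (filter-++ F? Us Ds) ⟩
  length (filter F? Us ++ filter F? Ds)               ≡⟨ length-++ (filter F? Us) ⟩
  length (filter F? Us) + length (filter F? Ds)       ≡⟨ cong (_+ length (filter F? Ds)) startU ⟩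
  ballot m (suc h) + length (filter F? Ds)            ≡⟨ startD h ⟩
  ballot (suc m) h                                    ∎
  where
  open ≡-Reasoning
  F? = descent? h (suc m)
  Us = map (U ∷_) (pathsOfLength m)
  Ds = map (D ∷_) (pathsOfLength m)

  startU : length (filter F? Us) ≡ ballot m (suc h)
  startU = trans
    (length-filter-map F? (descent? (suc h) m) (U ∷_) (descent-U h m) (pathsOfLength m))
    (length-filter-descents m (suc h))

  startD : ∀ h → ballot m (suc h) + length (filter (descent? h (suc m)) Ds) ≡ ballot (suc m) h
  startD zero = begin
    ballot m 1 + length (filter (descent? 0 (suc m)) Ds)
      ≡⟨ cong (λ ps → ballot m 1 + length ps)
           (filter-none (descent? 0 (suc m))
             (map⁺ {f = D ∷_} (universal (¬descent-D (suc m)) (pathsOfLength m)))) ⟩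
    ballot m 1 + 0
      ≡⟨ +-identityʳ _ ⟩
    ballot m 1 ∎
  startD (suc h) = cong (_+_ (ballot m (suc (suc h)))) (trans
    (length-filter-map (descent? (suc h) (suc m)) (descent? h m) (D ∷_) (descent-D h m) (pathsOfLength m))
    (length-filter-descents m h))

-- Ballot numbers as differences of binomial coefficients

m<h⇒ballot≡0 : ∀ m h → m < h → ballot m h ≡ 0
m<h⇒ballot≡0 zero    (suc h) _   = refl
m<h⇒ballot≡0 (suc m) (suc h) m<h =
  cong₂ _+_ (m<h⇒ballot≡0 m (suc (suc h)) (≤-trans m<h′ (≤-trans (n≤1+n h) (n≤1+n _))))
            (m<h⇒ballot≡0 m h m<h′)
  where m<h′ = s<s⁻¹ m<h

-- Induction on m by Pascal's rule; u is the number of up steps of the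
-- descents counted, and h + u the number of down steps.
ballot-closed : ∀ m h u → m ≡ h + u + u →
  ballot m h + m C suc (h + u) ≡ m C (h + u)
ballot-closed zero    zero    zero    _  = refl
ballot-closed (suc m) zero    (suc u) eq = begin
  ballot m 1 + suc m C suc (suc u)                ≡⟨ cong (_+_ _) (sym (nCk+nC[k+1]≡[n+1]C[k+1] m (suc u))) ⟩
  ballot m 1 + (m C suc u + m C suc (suc u))      ≡⟨ swap (ballot m 1) (m C suc u) _ ⟩
  (ballot m 1 + m C suc (suc u)) + m C suc u      ≡⟨ cong (_+ m C suc u) (ballot-closed m 1 u m≡) ⟩
  m C suc u + m C suc u                           ≡⟨ cong (_+ m C suc u) middle ⟩
  m C u + m C suc u                               ≡⟨ nCk+nC[k+1]≡[n+1]C[k+1] m u ⟩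
  suc m C suc u                                   ∎
  where
  open ≡-Reasoning
  swap : ∀ a b c → a + (b + c) ≡ (a + c) + b
  swap = ℕ-Solver.solve-∀
  m≡ : m ≡ suc u + u
  m≡ = trans (suc-injective eq) (+-suc u u)
  -- Row m = 2u + 1 has two equal middle entries.
  middle : m C suc u ≡ m C u
  middle = begin
    m C suc u              ≡⟨ cong (_C suc u) m≡ ⟩
    (suc u + u) C suc u    ≡⟨ nCk≡nC[n∸k] (m≤m+n (suc u) u) ⟩
    (suc u + u) C (suc u + u ∸ suc u) ≡⟨ cong ((suc u + u) C_) (m+n∸m≡n (suc u) u) ⟩
    (suc u + u) C u        ≡⟨ cong (_C u) (sym m≡) ⟩
    m C u                  ∎
ballot-closed (suc m) (suc h) u eq = begin
  (ballot m (suc (suc h)) + ballot m h) + suc m C suc (suc x)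
    ≡⟨ cong (_+_ _) (sym (nCk+nC[k+1]≡[n+1]C[k+1] m (suc x))) ⟩
  (ballot m (suc (suc h)) + ballot m h) + (m C suc x + m C suc (suc x))
    ≡⟨ interchange (ballot m (suc (suc h))) (ballot m h) _ _ ⟩
  (ballot m h + m C suc x) + (ballot m (suc (suc h)) + m C suc (suc x))
    ≡⟨ cong₂ _+_ (ballot-closed m h u m≡) (up u m≡) ⟩
  m C x + m C suc x
    ≡⟨ nCk+nC[k+1]≡[n+1]C[k+1] m x ⟩
  suc m C suc x ∎
  where
  open ≡-Reasoning
  x = h + u
  m≡ : m ≡ h + u + u
  m≡ = suc-injective eq
  interchange : ∀ a b c d → (a + b) + (c + d) ≡ (b + c) + (a + d)
  interchange = ℕ-Solver.solve-∀

  up : ∀ u → m ≡ h + u + u →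
    ballot m (suc (suc h)) + m C suc (suc (h + u)) ≡ m C suc (h + u)
  -- Without up steps left, all three terms vanish.  The first two rewrites both
  -- turn h + 0 into h, in eq′ through its instance h + 0 + 0.
  up zero    eq′ rewrite +-identityʳ h | +-identityʳ h | eq′
    | m<h⇒ballot≡0 h (suc (suc h)) (≤-trans (n<1+n h) (n≤1+n _))
    | k>n⇒nCk≡0 (n<1+n h) | k>n⇒nCk≡0 (≤-trans (n<1+n h) (n≤1+n (suc h))) = refl
  up (suc u) eq′ rewrite +-suc h u =
    ballot-closed m (suc (suc h)) u (trans eq′ (cong suc (+-suc (h + u) u)))

-- The absorption identity (k + 1) C(n, k + 1) = (n - k) C(n, k), in a form free
-- of subtraction.
absorption : ∀ n k → suc k * (n C suc k) + k * (n C k) ≡ n * (n C k)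
absorption zero    zero    = refl
absorption zero    (suc k) = cong₂ _+_ (*-zeroʳ k) (*-zeroʳ k)
absorption (suc n) zero    = begin
  1 * (suc n C 1) + 0  ≡⟨ +-identityʳ _ ⟩
  1 * (suc n C 1)      ≡⟨ *-identityˡ _ ⟩
  suc n C 1            ≡⟨ nC1≡n (suc n) ⟩
  suc n                ≡⟨ *-identityʳ (suc n) ⟨
  suc n * 1            ∎
  where open ≡-Reasoning
absorption (suc n) (suc k) = begin
  suc (suc k) * (suc n C suc (suc k)) + suc k * (suc n C suc k)
    ≡⟨ cong₂ (λ s t → suc (suc k) * s + suc k * t)
         (nCk+nC[k+1]≡[n+1]C[k+1] n (suc k)) (nCk+nC[k+1]≡[n+1]C[k+1] n k) ⟨
  suc (suc k) * (β + γ) + suc k * (α + β)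
    ≡⟨ regroup k α β γ ⟩
  (suc (suc k) * γ + suc k * β) + (suc k * β + k * α) + (α + β)
    ≡⟨ cong₂ (λ s t → s + t + (α + β)) (absorption n (suc k)) (absorption n k) ⟩
  n * β + n * α + (α + β)
    ≡⟨ collect n α β ⟩
  suc n * (α + β)
    ≡⟨ cong (suc n *_) (nCk+nC[k+1]≡[n+1]C[k+1] n k) ⟩
  suc n * (suc n C suc k) ∎
  where
  open ≡-Reasoning
  α = n C k
  β = n C suc k
  γ = n C suc (suc k)
  regroup : ∀ k a b c → (2 + k) * (b + c) + (1 + k) * (a + b)
    ≡ ((2 + k) * c + (1 + k) * b) + ((1 + k) * b + k * a) + (a + b)
  regroup = ℕ-Solver.solve-∀
  collect : ∀ n a b → n * b + n * a + (a + b) ≡ (1 + n) * (a + b)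
  collect = ℕ-Solver.solve-∀

ballot≡catalan : ∀ k → ballot (2 * k) 0 ≡ catalan k
ballot≡catalan k = begin
  N                     ≡⟨ m*n/n≡m N (suc k) ⟨
  N * suc k / suc k     ≡⟨ /-congˡ (+-cancelʳ-≡ (k * M) _ _ N*[k+1]) ⟩
  M / suc k             ∎
  where
  open ≡-Reasoning
  N = ballot (2 * k) 0
  M = (2 * k) C k
  M′ = (2 * k) C suc k

  double : ∀ k m → 2 * k * m ≡ k * m + k * m
  double = ℕ-Solver.solve-∀

  [k+1]*M′ : suc k * M′ ≡ k * M
  [k+1]*M′ = +-cancelʳ-≡ (k * M) _ _ (trans (absorption (2 * k) k) (double k M))

  N*[k+1] : N * suc k + k * M ≡ M + k * M
  N*[k+1] = begin
    N * suc k + k * M       ≡⟨ cong (_+_ (N * suc k)) [k+1]*M′ ⟨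
    N * suc k + suc k * M′  ≡⟨ factor k N M′ ⟩
    suc k * (N + M′)        ≡⟨ cong (suc k *_) (ballot-closed (2 * k) 0 k (cong (_+_ k) (+-identityʳ k))) ⟩
    suc k * M               ∎
    where
    factor : ∀ k n m → n * (1 + k) + (1 + k) * m ≡ (1 + k) * (n + m)
    factor = ℕ-Solver.solve-∀

-- Passing from d-Dyck paths to ballot numbers

r≡ballot : ∀ e k → k ≤ e + 3 → r (- (+ e)) k ≡ ballot (2 * k) 0
r≡ballot e k k≤e+3 = trans
  (cong length (filter-≐ _ (descent? 0 (2 * k)) (to , from) (pathsOfLength (2 * k))))
  (length-filter-descents (2 * k) 0)
  where
  to : ∀ {P} → Is (- (+ e)) -Dyck P × semiLength P ≡ k → Descent 0 (2 * k) P
  to ((dyck , _) , refl) = dyck , length-dyck dyck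
  from : ∀ {P} → Descent 0 (2 * k) P → Is (- (+ e)) -Dyck P × semiLength P ≡ k
  from {P} (dyck , len) = short⇒dDyck e dyck (subst (_≤ e + 3) (sym s≡k) k≤e+3) , s≡k
    where
    s≡k : semiLength P ≡ k
    s≡k = *-cancelˡ-≡ _ _ 2 (trans (sym (length-dyck dyck)) len)

theorem2p2 : ∀ (d : ℤ) → d <ℤ 0ℤ → ∀ (k : ℕ) → 1 ≤ k → k ≤ ∣ d ∣ + 3 →
    coeff k (L ∣ d ∣) ≡ catalan k
theorem2p2 d _ k@(suc _) _ k≤e+3 = trans (r≡ballot ∣ d ∣ k k≤e+3) (ballot≡catalan k)
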